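{- Let $S$ be a numerical semigroup with multiplicity $m$ and embedding dimension $\nu$. If $m-\nu=5$, then $S$ satisfies Wilf's Conjecture, i.e. $f+1\le \nu n$.
   Context: A numerical semigroup is a submonoid of $(\mathbb N,+)$ with finite complement. $f$ is its Frobenius number (largest integer not in $S$), $m$ its smallest nonzero element, $\nu$ its minimal number of generators, and $n=|\{s\in S: s<f\}|$. -}

module Defs where

open import Data.Nat using (ℕ; zero; suc; _+_; _*_; _≤_; _<_)
open import Data.Product using (Σ; ∃; _×_; _,_)
open import Data.Empty using (⊥)
open import Data.List using (List; length)
open import Data.List.Membership.Propositional using (_∈_)
open import Data.List.Relation.Unary.Unique.Propositional using (Unique)
open import Relation.Nullary using (¬_)

record NumericalSemigroup : Set₁ where
  field
    _∈S       : ℕ → Set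
    zero∈S    : zero ∈S
    +-closed  : ∀ {x y} → x ∈S → y ∈S → (x + y) ∈S
    cofinite  : ∃ λ b → ∀ x → b ≤ x → x ∈S

open NumericalSemigroup public

IsFrobenius : NumericalSemigroup → ℕ → Set
IsFrobenius S f = ¬ (_∈S S f) × (∀ x → f < x → _∈S S x)

IsMultiplicity : NumericalSemigroup → ℕ → Set
IsMultiplicity S m = (0 < m) × _∈S S m × (∀ x → 0 < x → x < m → ¬ (_∈S S x))

IsMinimalGenerator : NumericalSemigroup → ℕ → Set
IsMinimalGenerator S a =
  (0 < a) × _∈S S a ×
  ¬ (Σ ℕ λ x → Σ ℕ λ y → (0 < x) × (0 < y) × _∈S S x × _∈S S y × (x + y ≡ a))
  where open import Relation.Binary.PropositionalEquality using (_≡_)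

HasCardinality : (ℕ → Set) → ℕ → Set
HasCardinality P k =
  Σ (List ℕ) λ xs → Unique xs × (∀ x → (x ∈ xs → P x) × (P x → x ∈ xs)) × (length xs ≡ k)
  where open import Relation.Binary.PropositionalEquality using (_≡_)

IsEmbeddingDimension : NumericalSemigroup → ℕ → Set
IsEmbeddingDimension S ν = HasCardinality (IsMinimalGenerator S) ν

IsSmallElementsCount : NumericalSemigroup → ℕ → ℕ → Set
IsSmallElementsCount S f n = HasCardinality (λ s → _∈S S s × (s < f)) n

{-# OPTIONS --safe #-}
module Submission where

-- Put W = f + m, the largest element of the Apéry set Ap of S with respect to m, and write
-- W − w = g(w) m + r(w) with 0 ≤ r(w) < m, q = g(0), r₀ = r(0), ρ = m − 1 − r₀.  The class of
-- w ∈ Ap contains g(w) elements of S below f, and f + 1 = q m − ρ.  So n ≥ q + Σ g(v) for distinct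
-- nonzero v ∈ Ap, and for m = ν + 5 Wilf's inequality follows from 5 q ≤ ν Σ g(v) + ρ.
--
-- Call u, v an edge if u, v ∈ S are nonzero and u + v ∈ Ap.  Then (W − u) + (W − v) ≥ W, so
-- g(u) + g(v) ≥ q, except that q − 1 is possible when r(u), r(v) > r₀.  Hence h = 2 g + [r > r₀]
-- satisfies h(u) + h(v) ≥ 2 q, also for a loop u = v; and at most ρ elements of Ap have r > r₀, as
-- their values of r differ.  It remains to cover enough distinct elements by disjoint edges and
-- loops: 5 if ν = 2, 4 if ν = 3, 3 if ν = 4; for ν ≥ 5 one edge (or two loops) and an endpoint of
-- another edge suffice.
--
-- Exactly five nonzero elements of Ap are not minimal generators.  If a ≠ b and c are generators
-- with a + b + c ∈ Ap, then {a, b + c} and {b, a + c} are disjoint edges, so for small ν these five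
-- elements are sums of two generators or multiples of one, and there are few such configurations.

open import Defs
open import Data.Bool using (if_then_else_)
open import Data.List using (List; []; _∷_; _++_; length; map; filter; concatMap; applyUpTo)
open import Data.List.Properties using (length-++; length-++-sucʳ; length-applyUpTo)
open import Data.List.Membership.Propositional using (_∈_; _∉_)
open import Data.List.Membership.Propositional.Properties using (∈-∃++; ∈-++⁺ˡ; ∈-++⁺ʳ; ∈-++⁻; ∈-applyUpTo⁺; ∈-applyUpTo⁻; ∈-filter⁺; ∈-filter⁻; ∈-map⁺)
open import Data.List.Relation.Unary.All as All using (All; []; _∷_)
open import Data.List.Relation.Unary.AllPairs using ([]; _∷_)
open import Data.List.Relation.Unary.Any using (here; there)
open import Data.List.Relation.Unary.Unique.Propositional using (Unique)
open import Data.List.Relation.Unary.Unique.Propositional.Properties using (applyUpTo⁺₁; filter⁺; ++⁺)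
open import Data.Nat using (ℕ; zero; suc; _+_; _*_; _∸_; _/_; _%_; _≤_; _<_; z≤n; s≤s; z<s; NonZero; >-nonZero; _<?_; _≟_)
open import Data.Nat.DivMod using (m≡m%n+[m/n]*n; m%n<n; m≥n⇒m/n>0; m/n*n≤m; [m+kn]%n≡m%n; m<n⇒m%n≡m; /-monoˡ-≤; m*n/n≡m; m%n%n≡m%n)
open import Data.Nat.Induction using (<-rec)
open import Data.Nat.ListAction using (sum)
open import Data.Nat.Properties hiding (_≟_; _<?_)
open import Data.Nat.Tactic.RingSolver using (solve-∀)
open import Data.Product using (Σ; ∃; _×_; _,_; proj₁; proj₂)
open import Data.Sum using (_⊎_; inj₁; inj₂)
open import Relation.Binary.Definitions using (tri<; tri≈; tri>)
open import Relation.Binary.PropositionalEquality using (_≡_; _≢_; refl; sym; trans; cong; cong₂; subst; subst₂; ≢-sym; module ≡-Reasoning)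
open import Relation.Nullary using (¬_; Dec; yes; no; does; contradiction; ¬?; _×-dec_)
open import Data.List.Membership.DecPropositional _≟_ using (_∈?_)

-- Counting in duplicate-free lists

injection⇒length≤ : (φ : ℕ → ℕ) {xs ys : List ℕ} → Unique xs → (∀ {x} → x ∈ xs → φ x ∈ ys) →
  (∀ {x y} → x ∈ xs → y ∈ xs → φ x ≡ φ y → x ≡ y) → length xs ≤ length ys
injection⇒length≤ φ {[]} _ _ _ = z≤n
injection⇒length≤ φ {x ∷ xs} {ys} (x∉xs ∷ xs!) into inj with ∈-∃++ (into (here refl))
... | ls , rs , refl = subst (suc (length xs) ≤_) (sym (length-++-sucʳ ls (φ x) rs))
        (s≤s (injection⇒length≤ φ xs! avoid (λ p r → inj (there p) (there r))))
  where
  -- Injectivity keeps the images of the other elements off the deleted entry `φ x`.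
  avoid : ∀ {y} → y ∈ xs → φ y ∈ ls ++ rs
  avoid y∈xs with ∈-++⁻ ls (into (there y∈xs))
  ... | inj₁ p           = ∈-++⁺ˡ p
  ... | inj₂ (here eq)   = contradiction (inj (here refl) (there y∈xs) (sym eq)) (All.lookup x∉xs y∈xs)
  ... | inj₂ (there p)   = ∈-++⁺ʳ ls p

⊆⇒length≤ : {xs ys : List ℕ} → Unique xs → (∀ {x} → x ∈ xs → x ∈ ys) → length xs ≤ length ys
⊆⇒length≤ xs! into = injection⇒length≤ (λ x → x) xs! into (λ _ _ eq → eq)

∉⇒All≢ : {x : ℕ} {xs : List ℕ} → x ∉ xs → All (x ≢_) xs
∉⇒All≢ x∉xs = All.tabulate λ y∈xs eq → x∉xs (subst (_∈ _) (sym eq) y∈xs)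

-- In every use `R` contains the final inequality: an element may prove it at once or supply
-- information.
either-all : {R : Set} {P : ℕ → Set} (xs : List ℕ) → (∀ {x} → x ∈ xs → R ⊎ P x) → R ⊎ (∀ {x} → x ∈ xs → P x)
either-all [] _ = inj₂ λ ()
either-all (x ∷ xs) h with h (here refl) | either-all xs (λ p → h (there p))
... | inj₁ r  | _       = inj₁ r
... | inj₂ _  | inj₁ r  = inj₁ r
... | inj₂ px | inj₂ ps = inj₂ λ { (here refl) → px ; (there p) → ps p }

module _ {P : ℕ → Set} (P? : ∀ x → Dec (P x)) where

  indicator : ℕ → ℕ
  indicator x = if does (P? x) then 1 else 0

  indicator≤1 : ∀ x → indicator x ≤ 1
  indicator≤1 x with P? x
  ... | yes _ = ≤-refl
  ... | no  _ = z≤n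

  indicator≡1 : ∀ x → P x → indicator x ≡ 1
  indicator≡1 x px with P? x
  ... | yes _  = refl
  ... | no ¬px = contradiction px ¬px

  sum-indicator≡length-filter : ∀ xs → sum (map indicator xs) ≡ length (filter P? xs)
  sum-indicator≡length-filter [] = refl
  sum-indicator≡length-filter (x ∷ xs) with P? x
  ... | yes _ = cong suc (sum-indicator≡length-filter xs)
  ... | no  _ = sum-indicator≡length-filter xs

  sum-indicator≤length : ∀ xs → sum (map indicator xs) ≤ length xs
  sum-indicator≤length []       = z≤n
  sum-indicator≤length (x ∷ xs) = +-mono-≤ (indicator≤1 x) (sum-indicator≤length xs)

-- Numerical inequalities

carry : ∀ m .{{_ : NonZero m}} q r₀ a b {r s} → r < m → s < m → r₀ + q * m ≤ (r + a * m) + (s + b * m) →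
  q ≤ a + b ⊎ (r₀ < r × r₀ < s × q ≤ suc (a + b))
carry m q r₀ a b {r} {s} r<m s<m le with ≤-<-connex q (a + b)
... | inj₁ q≤   = inj₁ q≤
... | inj₂ a+b< = inj₂ (r₀<r , r₀<s , m<1+n⇒m≤n (*-cancelʳ-< m q (suc (suc (a + b))) q<))
  where
  open ≤-Reasoning
  regroup : ∀ r s a b m → (r + a * m) + (s + b * m) ≡ r + s + (a + b) * m
  regroup = solve-∀
  regroup₁ : ∀ r₀ c m → r₀ + suc c * m ≡ m + r₀ + c * m
  regroup₁ = solve-∀
  regroup₂ : ∀ c m → m + m + c * m ≡ suc (suc c) * m
  regroup₂ = solve-∀
  -- If a + b < q, the remainders must make up for a whole m. Both are below m, so each exceeds r₀,
  -- and r + s < 2 m limits the deficit to one.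
  m+r₀≤ : m + r₀ ≤ r + s
  m+r₀≤ = +-cancelʳ-≤ ((a + b) * m) (m + r₀) (r + s) (begin
    m + r₀ + (a + b) * m      ≡⟨ regroup₁ r₀ (a + b) m ⟨
    r₀ + suc (a + b) * m      ≤⟨ +-monoʳ-≤ r₀ (*-monoˡ-≤ m a+b<) ⟩
    r₀ + q * m                ≤⟨ le ⟩
    (r + a * m) + (s + b * m) ≡⟨ regroup r s a b m ⟩
    r + s + (a + b) * m       ∎)
  r₀<r : r₀ < r
  r₀<r = +-cancelˡ-< m r₀ r (begin-strict
    m + r₀ ≤⟨ m+r₀≤ ⟩
    r + s  <⟨ +-monoʳ-< r s<m ⟩
    r + m  ≡⟨ +-comm r m ⟩
    m + r  ∎)
  r₀<s : r₀ < s
  r₀<s = +-cancelˡ-< m r₀ s (begin-strict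
    m + r₀ ≤⟨ m+r₀≤ ⟩
    r + s  <⟨ +-monoˡ-< s r<m ⟩
    m + s  ∎)
  q< : q * m < suc (suc (a + b)) * m
  q< = begin-strict
    q * m                     ≤⟨ m≤n+m (q * m) r₀ ⟩
    r₀ + q * m                ≤⟨ le ⟩
    (r + a * m) + (s + b * m) ≡⟨ regroup r s a b m ⟩
    r + s + (a + b) * m       <⟨ +-monoˡ-< ((a + b) * m) (+-mono-< r<m s<m) ⟩
    m + m + (a + b) * m       ≡⟨ regroup₂ (a + b) m ⟩
    suc (suc (a + b)) * m     ∎

-- The `weight` lemmas turn bounds on sums of `h` into the hypothesis of `criterion`; `s` stands for
-- a sum of `g`, `x` for a sum of `e`.
weight₅ : ∀ {q s x ρ ν} → 5 * q ≤ 2 * s + x → x ≤ ρ → 2 ≤ ν → 5 * q ≤ ν * s + ρ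
weight₅ {s = s} le x≤ρ 2≤ν = ≤-trans le (+-mono-≤ (*-monoˡ-≤ s 2≤ν) x≤ρ)

-- Triple the hypothesis: two copies of x are absorbed by ρ, the third is at most 4 ≤ 2 q, which
-- lowers 12 q to 10 q.
weight₄ : ∀ {q s x ρ ν} → 4 * q ≤ 2 * s + x → x ≤ 4 → x ≤ ρ → 2 ≤ q → 3 ≤ ν → 5 * q ≤ ν * s + ρ
weight₄ {q} {s} {x} {ρ} {ν} le x≤4 x≤ρ 2≤q 3≤ν = ≤-trans (*-cancelˡ-≤ 2 (+-cancelʳ-≤ 4 _ _ (begin
  2 * (5 * q) + 2 * 2           ≤⟨ +-monoʳ-≤ (2 * (5 * q)) (*-monoʳ-≤ 2 2≤q) ⟩
  2 * (5 * q) + 2 * q           ≡⟨ regroup q ⟩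
  3 * (4 * q)                   ≤⟨ *-monoʳ-≤ 3 le ⟩
  3 * (2 * s + x)               ≡⟨ regroup′ s x ⟩
  2 * (3 * s) + 2 * x + x       ≤⟨ +-mono-≤ (+-monoʳ-≤ (2 * (3 * s)) (*-monoʳ-≤ 2 x≤ρ)) x≤4 ⟩
  2 * (3 * s) + 2 * ρ + 4       ≡⟨ cong (_+ 4) (*-distribˡ-+ 2 (3 * s) ρ) ⟨
  2 * (3 * s + ρ) + 4           ∎))) (+-monoˡ-≤ ρ (*-monoˡ-≤ s 3≤ν))
  where
  open ≤-Reasoning
  regroup : ∀ q → 2 * (5 * q) + 2 * q ≡ 3 * (4 * q)
  regroup = solve-∀
  regroup′ : ∀ s x → 3 * (2 * s + x) ≡ 2 * (3 * s) + 2 * x + x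
  regroup′ = solve-∀

-- Double the hypothesis: one x is absorbed by ρ, the other is at most 3 and is paid by the spare q
-- if q ≥ 3. For q = 2, already 4 s ≥ 12.
weight₃ : ∀ {q s x ρ ν} → 3 * q ≤ 2 * s + x → x ≤ 3 → x ≤ ρ → 3 ≤ s → 2 ≤ q → 4 ≤ ν → 5 * q ≤ ν * s + ρ
weight₃ {q} {s} {x} {ρ} {ν} le x≤3 x≤ρ 3≤s 2≤q 4≤ν = ≤-trans (bound (m≤n⇒m<n∨m≡n 2≤q)) (+-monoˡ-≤ ρ (*-monoˡ-≤ s 4≤ν))
  where
  open ≤-Reasoning
  regroup : ∀ q → 5 * q + q ≡ 2 * (3 * q)
  regroup = solve-∀
  regroup′ : ∀ s x → 2 * (2 * s + x) ≡ 4 * s + x + x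
  regroup′ = solve-∀
  bound : 2 < q ⊎ 2 ≡ q → 5 * q ≤ 4 * s + ρ
  bound (inj₂ refl) = begin
    10        ≤⟨ m≤m+n 10 2 ⟩
    4 * 3     ≤⟨ *-monoʳ-≤ 4 3≤s ⟩
    4 * s     ≤⟨ m≤m+n (4 * s) ρ ⟩
    4 * s + ρ ∎
  bound (inj₁ 3≤q) = +-cancelʳ-≤ 3 _ _ (begin
    5 * q + 3         ≤⟨ +-monoʳ-≤ (5 * q) 3≤q ⟩
    5 * q + q         ≡⟨ regroup q ⟩
    2 * (3 * q)       ≤⟨ *-monoʳ-≤ 2 le ⟩
    2 * (2 * s + x)   ≡⟨ regroup′ s x ⟩
    4 * s + x + x     ≤⟨ +-mono-≤ (+-monoʳ-≤ (4 * s) x≤ρ) x≤3 ⟩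
    4 * s + ρ + 3     ∎)

-- As x ≤ 2 ≤ 2 c, the third summand makes up for x, and q ≤ a + b + c.
weight₂ : ∀ {q a b c x ρ ν} → 2 * q ≤ 2 * (a + b) + x → x ≤ 2 → 0 < c → 5 ≤ ν → 5 * q ≤ ν * (a + (b + (c + 0))) + ρ
weight₂ {q} {a} {b} {c} {x} {ρ} {ν} le x≤2 0<c 5≤ν = ≤-trans
  (*-mono-≤ {5} {ν} {q} 5≤ν (*-cancelˡ-≤ 2 (begin
    2 * q                         ≤⟨ le ⟩
    2 * (a + b) + x               ≤⟨ +-monoʳ-≤ (2 * (a + b)) (≤-trans x≤2 (*-monoʳ-≤ 2 0<c)) ⟩
    2 * (a + b) + 2 * c           ≡⟨ regroup a b c ⟩
    2 * (a + (b + (c + 0)))       ∎)))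
  (m≤m+n _ ρ)
  where
  open ≤-Reasoning
  regroup : ∀ a b c → 2 * (a + b) + 2 * c ≡ 2 * (a + (b + (c + 0)))
  regroup = solve-∀

-- The fixed semigroup and membership in it

module Wilf (S : NumericalSemigroup) (f m ν n : ℕ)
  (frobenius : IsFrobenius S f) (multiplicity : IsMultiplicity S m)
  (embedding : IsEmbeddingDimension S ν) (small : IsSmallElementsCount S f n)
  (m≡ν+5 : m ≡ ν + 5) where

  In : ℕ → Set
  In = _∈S S

  Gen : ℕ → Set
  Gen = IsMinimalGenerator S

  Goal : Set
  Goal = f + 1 ≤ ν * n

  m>0 : 0 < m
  m>0 = proj₁ multiplicity

  m∈S : In m
  m∈S = proj₁ (proj₂ multiplicity)

  instance
    m-nonZero : NonZero m
    m-nonZero = >-nonZero m>0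

  small-elements : List ℕ
  small-elements = proj₁ small

  -- Below f the list in `small` decides, from f on the Frobenius property. The searches in
  -- `decompose` and `class-minimum` rely on this.
  in? : ∀ x → Dec (In x)
  in? x with <-cmp x f
  ... | tri≈ _ refl _ = no (proj₁ frobenius)
  ... | tri> _ _ f<x = yes (proj₂ frobenius x f<x)
  ... | tri< x<f _ _ with x ∈? small-elements
  ...   | yes x∈ = yes (proj₁ (proj₁ (proj₁ (proj₂ (proj₂ small)) x) x∈))
  ...   | no  x∉ = no λ x∈S → x∉ (proj₂ (proj₁ (proj₂ (proj₂ small)) x) (x∈S , x<f))

  multiple-in : ∀ k {x} → In x → In (k * x)
  multiple-in zero    _   = zero∈S S
  multiple-in (suc k) x∈S = +-closed S x∈S (multiple-in k x∈S)

  m≤ : ∀ {x} → 0 < x → In x → m ≤ x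
  m≤ {x} x>0 x∈S with ≤-<-connex m x
  ... | inj₁ m≤x = m≤x
  ... | inj₂ x<m = contradiction x∈S (proj₂ (proj₂ multiplicity) x x>0 x<m)

  -- The Apéry set

  Ap : ℕ → Set
  Ap w = In w × (∀ {y} → In y → w ≢ y + m)

  W : ℕ
  W = f + m

  ap-0 : Ap 0
  ap-0 = zero∈S S , λ {y} _ eq → <⇒≢ (≤-trans m>0 (m≤n+m m y)) eq

  ap-+ˡ : ∀ u v → In u → In v → Ap (u + v) → Ap u
  ap-+ˡ u v u∈S v∈S (_ , min) = u∈S , λ {y} y∈S eq → min (+-closed S y∈S v∈S) (trans (cong (_+ v) eq) (swap y m v))
    where
    swap : ∀ y m v → y + m + v ≡ y + v + m
    swap = solve-∀

  ap-+ʳ : ∀ u v → In u → In v → Ap (u + v) → Ap v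
  ap-+ʳ u v u∈S v∈S ap = ap-+ˡ v u v∈S u∈S (subst Ap (+-comm u v) ap)

  -- Beyond W = f + m, subtracting m leaves a number above f, hence in S.
  ap≤W : ∀ {w} → Ap w → w ≤ W
  ap≤W {w} (_ , min) with ≤-<-connex w W
  ... | inj₁ w≤W = w≤W
  ... | inj₂ W<w = contradiction (sym (m∸n+n≡m (m+n≤o⇒n≤o f (<⇒≤ W<w))))
                     (min (proj₂ frobenius (w ∸ m) (m+n≤o⇒m≤o∸n (suc f) W<w)))

  ap-shift : ∀ {u v} k → Ap u → In v → u ≡ v + k * m → u ≡ v
  ap-shift {u} {v} zero    _         _   eq = trans eq (+-identityʳ v)
  ap-shift {u} {v} (suc k) (_ , min) v∈S eq =
    contradiction (trans eq (swap v k m)) (min (+-closed S v∈S (multiple-in k m∈S)))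
    where
    swap : ∀ v k m → v + suc k * m ≡ v + k * m + m
    swap = solve-∀

  -- Cancelling the smaller multiple of m leaves the case of `ap-shift`, where a positive shift
  -- would exhibit an element of S smaller by m.
  ap-fibres : ∀ {u v} i j → Ap u → Ap v → u + i * m ≡ v + j * m → u ≡ v
  ap-fibres {u} {v} i j apu apv eq with ≤-total i j
  ... | inj₁ i≤j with m≤n⇒∃[o]m+o≡n i≤j
  ...   | k , refl = ap-shift k apu (proj₁ apv) (+-cancelʳ-≡ (i * m) u (v + k * m) (trans eq (swap v i k m)))
    where
    swap : ∀ v i k m → v + (i + k) * m ≡ v + k * m + i * m
    swap = solve-∀
  ap-fibres {u} {v} i j apu apv eq | inj₂ j≤i with m≤n⇒∃[o]m+o≡n j≤i
  ...   | k , refl = sym (ap-shift k apv (proj₁ apu) (+-cancelʳ-≡ (j * m) v (u + k * m) (trans (sym eq) (swap u j k m))))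
    where
    swap : ∀ v i k m → v + (i + k) * m ≡ v + k * m + i * m
    swap = solve-∀

  -- For w in the Apéry set, g w is the number of elements of S below f that are congruent to w.
  g r : ℕ → ℕ
  g w = (W ∸ w) / m
  r w = (W ∸ w) % m

  -- Division of W - w by m

  q r₀ ρ : ℕ
  q  = W / m
  r₀ = W % m
  ρ  = m ∸ suc r₀

  large? : ∀ w → Dec (r₀ < r w)
  large? w = r₀ <? r w

  -- Doubling `g` lets the one unit that an edge may lack be split evenly between its ends, through
  -- `e`.
  e h : ℕ → ℕ
  e w = indicator large? w
  h w = 2 * g w + e w

  W-split : ∀ w → W ∸ w ≡ r w + g w * m
  W-split w = m≡m%n+[m/n]*n (W ∸ w) m

  -- Since W = w + r w + g w * m, equal remainders put u and v in the same class modulo m.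
  r-injective : ∀ {u v} → Ap u → Ap v → r u ≡ r v → u ≡ v
  r-injective {u} {v} apu apv eq = ap-fibres (g u) (g v) apu apv
    (+-cancelˡ-≡ (r u) _ _ (begin
      r u + (u + g u * m) ≡⟨ swap (r u) u (g u * m) ⟩
      u + (r u + g u * m) ≡⟨ cong (u +_) (W-split u) ⟨
      u + (W ∸ u)         ≡⟨ m+[n∸m]≡n (ap≤W apu) ⟩
      W                   ≡⟨ m+[n∸m]≡n (ap≤W apv) ⟨
      v + (W ∸ v)         ≡⟨ cong (v +_) (W-split v) ⟩
      v + (r v + g v * m) ≡⟨ swap v (r v) (g v * m) ⟩
      r v + (v + g v * m) ≡⟨ cong (_+ (v + g v * m)) eq ⟨
      r u + (v + g v * m) ∎))
    where
    open ≡-Reasoning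
    swap : ∀ a b c → a + (b + c) ≡ b + (a + c)
    swap = solve-∀

  1+r₀+ρ≡m : suc r₀ + ρ ≡ m
  1+r₀+ρ≡m = m+[n∸m]≡n (m%n<n W m)

  -- The elements counted have distinct remainders among the ρ numbers r₀ + 1, ..., m - 1.
  sum-e≤ρ : ∀ {vs} → Unique vs → All Ap vs → sum (map e vs) ≤ ρ
  sum-e≤ρ {vs} vs! aps = subst₂ _≤_ (sym (sum-indicator≡length-filter large? vs)) (length-applyUpTo (suc r₀ +_) ρ)
    (injection⇒length≤ r (filter⁺ large? vs!) into
      (λ p p′ → r-injective (All.lookup aps (proj₁ (∈-filter⁻ large? p))) (All.lookup aps (proj₁ (∈-filter⁻ large? p′)))))
    where
    into : ∀ {x} → x ∈ filter large? vs → r x ∈ applyUpTo (suc r₀ +_) ρ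
    into {x} p with proj₂ (∈-filter⁻ large? {xs = vs} p)
    ... | r₀<r = subst (_∈ applyUpTo (suc r₀ +_) ρ) (m+[n∸m]≡n r₀<r)
      (∈-applyUpTo⁺ (suc r₀ +_) (∸-monoˡ-< (m%n<n (W ∸ x) m) r₀<r))

  -- Counting small elements class by class

  fibre : ℕ → List ℕ
  fibre w = applyUpTo (λ j → w + j * m) (g w)

  length-fibres : ∀ vs → length (concatMap fibre vs) ≡ sum (map g vs)
  length-fibres []       = refl
  length-fibres (v ∷ vs) = trans (length-++ (fibre v)) (cong₂ _+_ (length-applyUpTo _ (g v)) (length-fibres vs))

  ∈-fibres⁻ : ∀ {x} vs → x ∈ concatMap fibre vs → ∃ λ w → w ∈ vs × ∃ λ j → j < g w × x ≡ w + j * m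
  ∈-fibres⁻ (v ∷ vs) x∈ with ∈-++⁻ (fibre v) x∈
  ... | inj₁ p = v , here refl , ∈-applyUpTo⁻ _ p
  ... | inj₂ p with ∈-fibres⁻ vs p
  ...   | w , w∈ , rest = w , there w∈ , rest

  fibres-unique : ∀ {vs} → Unique vs → All Ap vs → Unique (concatMap fibre vs)
  fibres-unique [] [] = []
  fibres-unique {v ∷ vs} (v∉ ∷ vs!) (ap ∷ aps) = ++⁺
    (applyUpTo⁺₁ _ (g v) (λ {i} {j} i<j _ eq → <⇒≢ i<j (*-cancelʳ-≡ i j m (+-cancelˡ-≡ v _ _ eq))))
    (fibres-unique vs! aps)
    disjoint
    where
    disjoint : ∀ {x} → ¬ (x ∈ fibre v × x ∈ concatMap fibre vs)
    disjoint (p , p′) with ∈-applyUpTo⁻ _ p | ∈-fibres⁻ vs p′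
    ... | i , _ , refl | w , w∈ , j , _ , eq =
      All.lookup v∉ w∈ (ap-fibres i j ap (All.lookup aps w∈) eq)

  -- For j < g w, adding m once more stays within W = f + m, so each listed number is at most f; it
  -- is not f because it lies in S.
  sum-g≤n : ∀ {vs} → Unique vs → All Ap vs → sum (map g vs) ≤ n
  sum-g≤n {vs} vs! aps = subst₂ _≤_ (length-fibres vs) (proj₂ (proj₂ (proj₂ small)))
    (⊆⇒length≤ (fibres-unique vs! aps) into)
    where
    open ≤-Reasoning
    into : ∀ {x} → x ∈ concatMap fibre vs → x ∈ small-elements
    into x∈ with ∈-fibres⁻ vs x∈
    ... | w , w∈ , j , j<g , refl =
      proj₂ (proj₁ (proj₂ (proj₂ small)) _) (x∈S , ≤∧≢⇒< x≤f (λ eq → proj₁ frobenius (subst In eq x∈S)))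
      where
      ap = All.lookup aps w∈
      x∈S : In (w + j * m)
      x∈S = +-closed S (proj₁ ap) (multiple-in j m∈S)
      swap : ∀ w j m → w + j * m + m ≡ w + suc j * m
      swap = solve-∀
      x≤f : w + j * m ≤ f
      x≤f = +-cancelʳ-≤ m _ f (begin
        w + j * m + m   ≡⟨ swap w j m ⟩
        w + suc j * m   ≤⟨ +-monoʳ-≤ w (*-monoˡ-≤ m j<g) ⟩
        w + g w * m     ≤⟨ +-monoʳ-≤ w (m/n*n≤m (W ∸ w) m) ⟩
        w + (W ∸ w)     ≡⟨ m+[n∸m]≡n (ap≤W ap) ⟩
        W               ∎)

  Part : ℕ → Set
  Part v = 0 < v × Ap v

  f+1+ρ≡q*m : f + 1 + ρ ≡ q * m
  f+1+ρ≡q*m = +-cancelʳ-≡ (suc r₀) _ _ (begin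
    f + 1 + ρ + suc r₀       ≡⟨ swap f ρ r₀ ⟩
    suc (f + (suc r₀ + ρ))   ≡⟨ cong (λ k → suc (f + k)) 1+r₀+ρ≡m ⟩
    suc W                    ≡⟨ cong suc (m≡m%n+[m/n]*n W m) ⟩
    suc r₀ + q * m           ≡⟨ +-comm (suc r₀) (q * m) ⟩
    q * m + suc r₀           ∎)
    where
    open ≡-Reasoning
    swap : ∀ f ρ r₀ → f + 1 + ρ + suc r₀ ≡ suc (f + (suc r₀ + ρ))
    swap = solve-∀

  -- Here q m = ν q + 5 q. The class of 0 contributes g 0 = q elements and pays for ν q; `vs` and ρ
  -- have to pay for 5 q.
  criterion : ∀ {vs} → Unique vs → All Part vs → 5 * q ≤ ν * sum (map g vs) + ρ → Goal
  criterion {vs} vs! parts le = +-cancelʳ-≤ ρ (f + 1) (ν * n) (begin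
    f + 1 + ρ                            ≡⟨ f+1+ρ≡q*m ⟩
    q * m                                ≡⟨ cong (q *_) m≡ν+5 ⟩
    q * (ν + 5)                          ≡⟨ swap q ν ⟩
    ν * q + 5 * q                        ≤⟨ +-monoʳ-≤ (ν * q) le ⟩
    ν * q + (ν * sum (map g vs) + ρ)     ≡⟨ swap′ ν q (sum (map g vs)) ρ ⟩
    ν * (q + sum (map g vs)) + ρ         ≤⟨ +-monoˡ-≤ ρ (*-monoʳ-≤ ν bound) ⟩
    ν * n + ρ                            ∎)
    where
    open ≤-Reasoning
    swap : ∀ q ν → q * (ν + 5) ≡ ν * q + 5 * q
    swap = solve-∀
    swap′ : ∀ ν q s ρ → ν * q + (ν * s + ρ) ≡ ν * (q + s) + ρ
    swap′ = solve-∀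
    bound : q + sum (map g vs) ≤ n
    bound = sum-g≤n (All.map (λ p eq → <⇒≢ (proj₁ p) eq) parts ∷ vs!) (ap-0 ∷ All.map proj₂ parts)

  -- Edges and loops

  record Edge (u v : ℕ) : Set where
    constructor edge
    field
      u>0 : 0 < u
      v>0 : 0 < v
      u∈S : In u
      v∈S : In v
      sum∈Ap : Ap (u + v)

    partˡ : Part u
    partˡ = u>0 , ap-+ˡ u v u∈S v∈S sum∈Ap

    partʳ : Part v
    partʳ = v>0 , ap-+ʳ u v u∈S v∈S sum∈Ap

    -- The other end is at least m and u + v ≤ W, so W - u ≥ m.
    0<gˡ : 0 < g u
    0<gˡ = m≥n⇒m/n>0 (≤-trans (m≤ v>0 v∈S) (m+n≤o⇒m≤o∸n v (subst (_≤ W) (+-comm u v) (ap≤W sum∈Ap))))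

    -- By `carry`, if the quotients fall one short of q, both remainders exceed r₀ and both values
    -- of `e` are 1.
    2q≤h+h : 2 * q ≤ h u + h v
    2q≤h+h with carry m q r₀ (g u) (g v) (m%n<n (W ∸ u) m) (m%n<n (W ∸ v) m) W≤
      where
      open ≤-Reasoning
      W≤ : r₀ + q * m ≤ (r u + g u * m) + (r v + g v * m)
      W≤ = begin
        r₀ + q * m                            ≡⟨ m≡m%n+[m/n]*n W m ⟨
        W                                     ≡⟨ m∸n+n≡m (ap≤W (proj₂ partˡ)) ⟨
        (W ∸ u) + u                           ≤⟨ +-monoʳ-≤ (W ∸ u) (m+n≤o⇒m≤o∸n u (ap≤W sum∈Ap)) ⟩
        (W ∸ u) + (W ∸ v)                     ≡⟨ cong₂ _+_ (W-split u) (W-split v) ⟩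
        (r u + g u * m) + (r v + g v * m)     ∎
    ... | inj₁ q≤ = begin
        2 * q                             ≤⟨ *-monoʳ-≤ 2 q≤ ⟩
        2 * (g u + g v)                   ≡⟨ *-distribˡ-+ 2 (g u) (g v) ⟩
        2 * g u + 2 * g v                 ≤⟨ +-mono-≤ (m≤m+n (2 * g u) (e u)) (m≤m+n (2 * g v) (e v)) ⟩
        h u + h v                         ∎
      where open ≤-Reasoning
    ... | inj₂ (lt , lt′ , q≤) = begin
        2 * q                             ≤⟨ *-monoʳ-≤ 2 q≤ ⟩
        2 * suc (g u + g v)               ≡⟨ swap (g u) (g v) ⟩
        (2 * g u + 1) + (2 * g v + 1)     ≡⟨ cong₂ (λ a b → (2 * g u + a) + (2 * g v + b)) (indicator≡1 large? u lt) (indicator≡1 large? v lt′) ⟨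
        h u + h v                         ∎
      where
      open ≤-Reasoning
      swap : ∀ a b → 2 * suc (a + b) ≡ (2 * a + 1) + (2 * b + 1)
      swap = solve-∀

    2≤q : 2 ≤ q
    2≤q = subst (_≤ q) (m*n/n≡m 2 m) (/-monoˡ-≤ m (≤-trans
      (subst (_≤ u + v) (cong (m +_) (sym (+-identityʳ m))) (+-mono-≤ (m≤ u>0 u∈S) (m≤ v>0 v∈S)))
      (ap≤W sum∈Ap)))

  open Edge

  loop : ∀ {u} → Edge u u → q ≤ h u
  loop {u} uu = *-cancelˡ-≤ 2 (subst (2 * q ≤_) (cong (h u +_) (sym (+-identityʳ (h u)))) (2q≤h+h uu))

  sum-h : ∀ vs → sum (map h vs) ≡ 2 * sum (map g vs) + sum (map e vs)
  sum-h []       = refl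
  sum-h (v ∷ vs) = trans (cong (h v +_) (sum-h vs)) (swap (g v) (e v) (sum (map g vs)) (sum (map e vs)))
    where
    swap : ∀ a b c d → 2 * a + b + (2 * c + d) ≡ 2 * (a + c) + (b + d)
    swap = solve-∀

  -- Wilf's inequality from disjoint edges and loops

  two-edges-loop : ∀ {a b c d x} → 2 ≤ ν → Edge a b → Edge c d → Edge x x → Unique (a ∷ b ∷ c ∷ d ∷ x ∷ []) → Goal
  two-edges-loop {a} {b} {c} {d} {x} 2≤ν ab cd xx vs! = criterion vs! parts
    (weight₅ {q} (subst (5 * q ≤_) (sum-h vs) bound) (sum-e≤ρ vs! (All.map proj₂ parts)) 2≤ν)
    where
    open ≤-Reasoning
    vs = a ∷ b ∷ c ∷ d ∷ x ∷ []
    parts : All Part vs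
    parts = partˡ ab ∷ partʳ ab ∷ partˡ cd ∷ partʳ cd ∷ partˡ xx ∷ []
    swap : ∀ q → 5 * q ≡ 2 * q + 2 * q + q
    swap = solve-∀
    swap′ : ∀ a b c d x → a + b + (c + d) + x ≡ a + (b + (c + (d + (x + 0))))
    swap′ = solve-∀
    bound : 5 * q ≤ sum (map h vs)
    bound = begin
      5 * q                        ≡⟨ swap q ⟩
      2 * q + 2 * q + q            ≤⟨ +-mono-≤ (+-mono-≤ (2q≤h+h ab) (2q≤h+h cd)) (loop xx) ⟩
      h a + h b + (h c + h d) + h x ≡⟨ swap′ (h a) (h b) (h c) (h d) (h x) ⟩
      sum (map h vs)               ∎

  -- The pair c, d enters through its bound on `h`, which may come from an edge or from two loops.
  four-matched : ∀ {a b c d} → 3 ≤ ν → Edge a b → 2 * q ≤ h c + h d → Part c → Part d →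
    Unique (a ∷ b ∷ c ∷ d ∷ []) → Goal
  four-matched {a} {b} {c} {d} 3≤ν ab le pc pd vs! = criterion vs! parts
    (weight₄ {q} (subst (4 * q ≤_) (sum-h vs) bound) (sum-indicator≤length large? vs) (sum-e≤ρ vs! (All.map proj₂ parts)) (2≤q ab) 3≤ν)
    where
    open ≤-Reasoning
    vs = a ∷ b ∷ c ∷ d ∷ []
    parts : All Part vs
    parts = partˡ ab ∷ partʳ ab ∷ pc ∷ pd ∷ []
    swap : ∀ q → 4 * q ≡ 2 * q + 2 * q
    swap = solve-∀
    swap′ : ∀ a b c d → a + b + (c + d) ≡ a + (b + (c + (d + 0)))
    swap′ = solve-∀
    bound : 4 * q ≤ sum (map h vs)
    bound = begin
      4 * q                        ≡⟨ swap q ⟩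
      2 * q + 2 * q                ≤⟨ +-mono-≤ (2q≤h+h ab) le ⟩
      h a + h b + (h c + h d)      ≡⟨ swap′ (h a) (h b) (h c) (h d) ⟩
      sum (map h vs)               ∎

  loops : ∀ {c d} → Edge c c → Edge d d → 2 * q ≤ h c + h d
  loops {c} {d} cc dd = ≤-trans (≤-reflexive (cong (q +_) (+-identityʳ q))) (+-mono-≤ (loop cc) (loop dd))

  two-edges : ∀ {a b c d} → 3 ≤ ν → Edge a b → Edge c d → Unique (a ∷ b ∷ c ∷ d ∷ []) → Goal
  two-edges 3≤ν ab cd = four-matched 3≤ν ab (2q≤h+h cd) (partˡ cd) (partʳ cd)

  edge-two-loops : ∀ {a b c d} → 3 ≤ ν → Edge a b → Edge c c → Edge d d → Unique (a ∷ b ∷ c ∷ d ∷ []) → Goal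
  edge-two-loops 3≤ν ab cc dd = four-matched 3≤ν ab (loops cc dd) (partˡ cc) (partˡ dd)

  flip : ∀ {a b} → Edge a b → Edge b a
  flip {a} {b} (edge a>0 b>0 a∈S b∈S ap) = edge b>0 a>0 b∈S a∈S (subst Ap (+-comm a b) ap)

  edge-loop : ∀ {a b c} → 4 ≤ ν → Edge a b → Edge c c → Unique (a ∷ b ∷ c ∷ []) → Goal
  edge-loop {a} {b} {c} 4≤ν ab cc vs! = criterion vs! parts
    (weight₃ {q} (subst (3 * q ≤_) (sum-h vs) bound) (sum-indicator≤length large? vs) (sum-e≤ρ vs! (All.map proj₂ parts))
      -- Every end has g ≥ 1; `weight₃` needs the resulting bound 3 for q = 2.
      (+-mono-≤ (0<gˡ ab) (+-mono-≤ (0<gˡ (flip ab)) (+-mono-≤ (0<gˡ cc) z≤n))) (2≤q ab) 4≤ν)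
    where
    open ≤-Reasoning
    vs = a ∷ b ∷ c ∷ []
    parts : All Part vs
    parts = partˡ ab ∷ partʳ ab ∷ partˡ cc ∷ []
    swap : ∀ q → 3 * q ≡ 2 * q + q
    swap = solve-∀
    swap′ : ∀ a b c → a + b + c ≡ a + (b + (c + 0))
    swap′ = solve-∀
    bound : 3 * q ≤ sum (map h vs)
    bound = begin
      3 * q                  ≡⟨ swap q ⟩
      2 * q + q              ≤⟨ +-mono-≤ (2q≤h+h ab) (loop cc) ⟩
      h a + h b + h c        ≡⟨ swap′ (h a) (h b) (h c) ⟩
      sum (map h vs)         ∎

  -- From the edge c d only g c > 0 is taken, so `d` may coincide with another element.
  matched-third : ∀ {a b c d} → 5 ≤ ν → 2 * q ≤ h a + h b → Part a → Part b → Edge c d → Unique (a ∷ b ∷ c ∷ []) → Goal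
  matched-third {a} {b} {c} 5≤ν le pa pb cd vs! = criterion vs! (pa ∷ pb ∷ partˡ cd ∷ [])
    (weight₂ {q} {g a} {g b} (subst (2 * q ≤_) (swap (g a) (e a) (g b) (e b)) le)
      (+-mono-≤ (indicator≤1 large? a) (indicator≤1 large? b)) (0<gˡ cd) 5≤ν)
    where
    swap : ∀ a b c d → 2 * a + b + (2 * c + d) ≡ 2 * (a + c) + (b + d)
    swap = solve-∀

  -- Minimal generators

  gs : List ℕ
  gs = proj₁ embedding

  ∈gs⇒gen : ∀ {a} → a ∈ gs → Gen a
  ∈gs⇒gen {a} = proj₁ (proj₁ (proj₂ (proj₂ embedding)) a)

  gen⇒∈gs : ∀ {a} → Gen a → a ∈ gs
  gen⇒∈gs {a} = proj₂ (proj₁ (proj₂ (proj₂ embedding)) a)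

  gen>0 : ∀ {a} → Gen a → 0 < a
  gen>0 = proj₁

  gen∈S : ∀ {a} → Gen a → In a
  gen∈S p = proj₁ (proj₂ p)

  gen≢+ : ∀ {a u v} → Gen a → 0 < u → 0 < v → In u → In v → a ≢ u + v
  gen≢+ {a} {u} {v} ga u>0 v>0 u∈S v∈S eq = proj₂ (proj₂ ga) (u , v , u>0 , v>0 , u∈S , v∈S , sym eq)

  decompose : ∀ {w} → In w → 0 < w → ¬ Gen w → ∃ λ u → ∃ λ v → 0 < u × 0 < v × In u × In v × w ≡ u + v
  decompose {w} w∈S w>0 ¬gen with anyUpTo? (λ u → (0 <? u) ×-dec (in? u ×-dec in? (w ∸ u))) w
  ... | yes (u , u<w , u>0 , u∈S , v∈S) = u , w ∸ u , u>0 , m<n⇒0<n∸m u<w , u∈S , v∈S , sym (m+[n∸m]≡n (<⇒≤ u<w))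
  ... | no none = contradiction (w>0 , w∈S , indecomposable) ¬gen
    where
    indecomposable : ¬ (Σ ℕ λ x → Σ ℕ λ y → (0 < x) × (0 < y) × In x × In y × (x + y ≡ w))
    indecomposable (x , y , x>0 , y>0 , x∈S , y∈S , refl) =
      none (x , m<m+n x y>0 , x>0 , x∈S , subst In (sym (m+n∸m≡n x y)) y∈S)

  -- Strong induction: a non-generator splits as u + w, and a generator split off from the smaller u
  -- is split off from the sum.
  gen-divides : ∀ v → In v → 0 < v → ∃ λ a → Gen a × ∃ λ s → In s × v ≡ a + s
  gen-divides = <-rec _ step
    where
    step : ∀ v → (∀ {u} → u < v → In u → 0 < u → ∃ λ a → Gen a × ∃ λ s → In s × u ≡ a + s) →
      In v → 0 < v → ∃ λ a → Gen a × ∃ λ s → In s × v ≡ a + s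
    step v rec v∈S v>0 with v ∈? gs
    ... | yes v∈gs = v , ∈gs⇒gen v∈gs , 0 , zero∈S S , sym (+-identityʳ v)
    ... | no  v∉gs with decompose v∈S v>0 (λ gen → v∉gs (gen⇒∈gs gen))
    ...   | u , w , u>0 , w>0 , u∈S , w∈S , refl with rec (m<m+n u w>0) u∈S u>0
    ...     | a , ga , s , s∈S , refl = a , ga , s + w , +-closed S s∈S w∈S , +-assoc a s w

  -- The generator m is removed because m + s with s in S is never in `Ap`.
  as : List ℕ
  as = filter (λ x → ¬? (x ≟ m)) gs

  -- Stated for any list, so that the final case analysis can match on its shape.
  Factors : List ℕ → Set
  Factors xs = ∀ {v} → Ap v → 0 < v → ∃ λ a → a ∈ xs × ∃ λ s → In s × v ≡ a + s

  factors : Factors as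
  factors {v} (v∈S , min) v>0 with gen-divides v v∈S v>0
  ... | a , ga , s , s∈S , refl =
    a , ∈-filter⁺ (λ x → ¬? (x ≟ m)) (gen⇒∈gs ga) (λ { refl → min s∈S (+-comm a s) }) , s , s∈S , refl

  as-gen : ∀ {a} → a ∈ as → Gen a
  as-gen p = ∈gs⇒gen (proj₁ (∈-filter⁻ (λ x → ¬? (x ≟ m)) {xs = gs} p))

  as-unique : Unique as
  as-unique = filter⁺ _ (proj₁ (proj₂ embedding))

  m-gen : Gen m
  m-gen = m>0 , m∈S , λ { (x , y , x>0 , y>0 , x∈S , _ , eq) →
    <⇒≱ (subst (x <_) eq (m<m+n x y>0)) (m≤ x>0 x∈S) }

  -- The generator m is missing from `as`. The final cases read their lower bounds on ν off this.
  length-as<ν : length as < ν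
  length-as<ν = subst (suc (length as) ≤_) (proj₂ (proj₂ (proj₂ embedding)))
    (⊆⇒length≤ (∉⇒All≢ (λ p → proj₂ (∈-filter⁻ (λ x → ¬? (x ≟ m)) {xs = gs} p) refl) ∷ as-unique)
      (λ { (here refl) → gen⇒∈gs m-gen ; (there p) → gen⇒∈gs (as-gen p) }))

  -- Apéry elements that are not generators

  class-minimum : ∀ i → ∃ λ w → Ap w × w % m ≡ i % m
  -- Start at i % m + (f + 1) m, which exceeds f, and go down by m until the next number is missing
  -- from S.
  class-minimum i with descend (suc f) (proj₂ frobenius _ (≤-trans (m≤m*n (suc f) m) (m≤n+m _ (i % m))))
    where
    descend : ∀ k → In (i % m + k * m) → ∃ λ w → Ap w × w % m ≡ i % m % m
    descend zero p = i % m , (subst In (+-identityʳ (i % m)) p ,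
      λ {y} _ eq → <⇒≱ (m%n<n i m) (subst (m ≤_) (sym eq) (m≤n+m m y))) , refl
    descend (suc k) p with in? (i % m + k * m)
    ... | yes p′ = descend k p′
    ... | no ¬p′ = _ , (p , λ {y} y∈S eq → ¬p′ (subst In (+-cancelʳ-≡ m y _ (trans (sym eq) (swap (i % m) k m))) y∈S)) ,
                   [m+kn]%n≡m%n (i % m) (suc k) m
      where
      swap : ∀ a k m → a + suc k * m ≡ a + k * m + m
      swap = solve-∀
  ... | w , ap , eq = w , ap , trans eq (m%n%n≡m%n i m)

  -- Index i stands for residue i + 1, which skips the class of 0.
  nonzero-apery : List ℕ
  nonzero-apery = applyUpTo (λ i → proj₁ (class-minimum (suc i))) (m ∸ 1)

  residue : ∀ {i} → i < m ∸ 1 → proj₁ (class-minimum (suc i)) % m ≡ suc i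
  residue {i} i<m-1 = trans (proj₂ (proj₂ (class-minimum (suc i))))
    (m<n⇒m%n≡m (subst (suc i <_) (m+[n∸m]≡n m>0) (s≤s i<m-1)))

  nonzero-apery-unique : Unique nonzero-apery
  nonzero-apery-unique = applyUpTo⁺₁ _ (m ∸ 1) λ {i} {j} i<j j<m-1 eq → <⇒≢ i<j (suc-injective
    (trans (sym (residue (<-trans i<j j<m-1))) (trans (cong (_% m) eq) (residue j<m-1))))

  nonzero-apery-part : ∀ {w} → w ∈ nonzero-apery → Part w
  nonzero-apery-part p with ∈-applyUpTo⁻ (λ i → proj₁ (class-minimum (suc i))) p
  ... | i , i<m-1 , refl = n≢0⇒n>0 (λ eq → 0≢1+n (trans (sym (m<n⇒m%n≡m m>0)) (trans (cong (_% m) (sym eq)) (residue i<m-1)))) ,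
                           proj₁ (proj₂ (class-minimum (suc i)))

  ds : List ℕ
  ds = filter (λ x → ¬? (x ∈? gs)) nonzero-apery

  ds-unique : Unique ds
  ds-unique = filter⁺ _ nonzero-apery-unique

  ds-part : ∀ {d} → d ∈ ds → Part d
  ds-part p = nonzero-apery-part (proj₁ (∈-filter⁻ (λ x → ¬? (x ∈? gs)) {xs = nonzero-apery} p))

  ds-nongen : ∀ {d} → d ∈ ds → ¬ Gen d
  ds-nongen p gen = proj₂ (∈-filter⁻ (λ x → ¬? (x ∈? gs)) {xs = nonzero-apery} p) (gen⇒∈gs gen)

  -- The m distinct numbers consisting of m and the nonzero Apéry elements all lie in `gs` or `ds`,
  -- so m ≤ ν + |ds|.
  5≤length-ds : 5 ≤ length ds
  5≤length-ds = +-cancelˡ-≤ ν 5 (length ds) (begin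
    ν + 5                          ≡⟨ m≡ν+5 ⟨
    m                              ≡⟨ m+[n∸m]≡n m>0 ⟨
    suc (m ∸ 1)                    ≡⟨ cong suc (length-applyUpTo _ (m ∸ 1)) ⟨
    suc (length nonzero-apery)     ≤⟨ ⊆⇒length≤ (∉⇒All≢ m∉ ∷ nonzero-apery-unique) into ⟩
    length (gs ++ ds)              ≡⟨ length-++ gs ⟩
    length gs + length ds          ≡⟨ cong (_+ length ds) (proj₂ (proj₂ (proj₂ embedding))) ⟩
    ν + length ds                  ∎)
    where
    open ≤-Reasoning
    m∉ : m ∉ nonzero-apery
    m∉ p = proj₂ (proj₂ (nonzero-apery-part p)) (zero∈S S) refl
    into : ∀ {x} → x ∈ m ∷ nonzero-apery → x ∈ gs ++ ds
    into (here refl) = ∈-++⁺ˡ (gen⇒∈gs m-gen)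
    into {x} (there p) with x ∈? gs
    ... | yes x∈gs = ∈-++⁺ˡ x∈gs
    ... | no  x∉gs = ∈-++⁺ʳ gs (∈-filter⁺ (λ x → ¬? (x ∈? gs)) p x∉gs)

  -- Pigeonhole: four values cannot hold the five elements of `ds`, so one of these proves the goal.
  crowded : ∀ ys → length ys ≤ 4 → (∀ {d} → d ∈ ds → Goal ⊎ d ∈ ys) → Goal
  crowded ys small-ys into with either-all ds into
  ... | inj₁ goal = goal
  ... | inj₂ ds⊆  = contradiction (≤-trans 5≤length-ds (≤-trans (⊆⇒length≤ ds-unique ds⊆) small-ys)) (<⇒≱ ≤-refl)

  ds-edge : ∀ {d} → d ∈ ds → ∃ λ u → ∃ λ v → Edge u v × d ≡ u + v
  ds-edge p with decompose (proj₁ (proj₂ (ds-part p))) (proj₁ (ds-part p)) (ds-nongen p)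
  ... | u , v , u>0 , v>0 , u∈S , v∈S , refl = u , v , edge u>0 v>0 u∈S v∈S (proj₂ (ds-part p)) , refl

  -- At least five generators

  many-generators : 5 ≤ ν → Goal
  many-generators 5≤ν with either-all ds classify
    where
    proper-edge : ∀ {u v} → Edge u v → u ≢ v → Goal
    -- An edge with an end outside {u, v} finishes; otherwise `ds` lies among three sums.
    proper-edge {u} {v} uv u≢v = crowded (u + u ∷ u + v ∷ v + v ∷ []) (s≤s (s≤s (s≤s z≤n))) inside
      where
      third : ∀ {x y} → Edge x y → x ≢ u → x ≢ v → Goal
      third xy x≢u x≢v = matched-third 5≤ν (2q≤h+h uv) (partˡ uv) (partʳ uv) xy
        ((u≢v ∷ ≢-sym x≢u ∷ []) ∷ (≢-sym x≢v ∷ []) ∷ [] ∷ [])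
      end : ∀ {x y} → Edge x y → Goal ⊎ (x ≡ u ⊎ x ≡ v)
      end {x} xy with x ≟ u | x ≟ v
      ... | yes x≡u | _       = inj₂ (inj₁ x≡u)
      ... | no _    | yes x≡v = inj₂ (inj₂ x≡v)
      ... | no x≢u  | no x≢v  = inj₁ (third xy x≢u x≢v)
      inside : ∀ {d} → d ∈ ds → Goal ⊎ d ∈ u + u ∷ u + v ∷ v + v ∷ []
      inside p with ds-edge p
      ... | x , y , xy , refl with end xy | end (flip xy)
      ...   | inj₁ goal        | _                 = inj₁ goal
      ...   | inj₂ _           | inj₁ goal         = inj₁ goal
      ...   | inj₂ (inj₁ refl) | inj₂ (inj₁ refl) = inj₂ (here refl)
      ...   | inj₂ (inj₁ refl) | inj₂ (inj₂ refl) = inj₂ (there (here refl))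
      ...   | inj₂ (inj₂ refl) | inj₂ (inj₁ refl) = inj₂ (there (here (+-comm x y)))
      ...   | inj₂ (inj₂ refl) | inj₂ (inj₂ refl) = inj₂ (there (there (here refl)))
    classify : ∀ {d} → d ∈ ds → Goal ⊎ (∃ λ u → Edge u u × d ≡ u + u)
    classify p with ds-edge p
    ... | u , v , uv , refl with u ≟ v
    ...   | yes refl = inj₂ (u , uv , refl)
    ...   | no u≢v   = inj₁ (proper-edge uv u≢v)
  ... | inj₁ goal = goal
  -- Now all of `ds` are doubles, and three of them give two loops and a third element.
  ... | inj₂ double = three-doubles ds ds-unique 5≤length-ds double
    where
    three-doubles : ∀ xs → Unique xs → 5 ≤ length xs → (∀ {d} → d ∈ xs → ∃ λ u → Edge u u × d ≡ u + u) → Goal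
    three-doubles (_ ∷ []) _ (s≤s ()) _
    three-doubles (_ ∷ _ ∷ []) _ (s≤s (s≤s ())) _
    three-doubles (d₁ ∷ d₂ ∷ d₃ ∷ _) ((d₁≢d₂ ∷ d₁≢d₃ ∷ _) ∷ (d₂≢d₃ ∷ _) ∷ _) _ dbl
      with dbl (here refl) | dbl (there (here refl)) | dbl (there (there (here refl)))
    ... | u , uu , refl | v , vv , refl | w , ww , refl =
      matched-third 5≤ν (loops uu vv) (partˡ uu) (partˡ vv) ww
        (((λ { refl → d₁≢d₂ refl }) ∷ (λ { refl → d₁≢d₃ refl }) ∷ []) ∷ ((λ { refl → d₂≢d₃ refl }) ∷ []) ∷ [] ∷ [])

  -- Multiples and sums of three generators

  ap-multiple : ∀ i j {x} → In x → Ap ((i + j) * x) → Ap (i * x)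
  ap-multiple i j {x} x∈S ap =
    ap-+ˡ (i * x) (j * x) (multiple-in i x∈S) (multiple-in j x∈S) (subst Ap (*-distribʳ-+ x i j) ap)

  multiple-edge : ∀ i j {x} → Gen x → Ap ((suc i + suc j) * x) → Edge (suc i * x) (suc j * x)
  multiple-edge i j {x} gx ap = edge
    (≤-trans (gen>0 gx) (m≤m+n x (i * x))) (≤-trans (gen>0 gx) (m≤m+n x (j * x)))
    (multiple-in (suc i) (gen∈S gx)) (multiple-in (suc j) (gen∈S gx)) (subst Ap (*-distribʳ-+ x (suc i) (suc j)) ap)

  multiple≢ : ∀ i j {x} → Gen x → i ≢ j → i * x ≢ j * x
  multiple≢ i j {x} gx i≢j eq = i≢j (*-cancelʳ-≡ i j x {{>-nonZero (gen>0 gx)}} eq)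

  gen≢multiple : ∀ {x y} → Gen x → Gen y → y ≢ x → ∀ k → y ≢ suc k * x
  gen≢multiple {x} gx gy y≢x zero eq = y≢x (trans eq (+-identityʳ x))
  gen≢multiple {x} gx gy y≢x (suc k) eq =
    gen≢+ gy (gen>0 gx) (≤-trans (gen>0 gx) (m≤m+n x (k * x))) (gen∈S gx) (multiple-in (suc k) (gen∈S gx)) eq

  -- The edges {a , b + c} and {b , a + c} are disjoint even if c is a or b.
  mixed : ∀ {a b c} → 3 ≤ ν → Gen a → Gen b → Gen c → a ≢ b → Ap (a + (b + c)) → Goal
  mixed {a} {b} {c} 3≤ν ga gb gc a≢b ap = two-edges 3≤ν
    (edge a>0 (≤-trans b>0 (m≤m+n b c)) a∈S (+-closed S b∈S c∈S) ap)
    (edge b>0 (≤-trans a>0 (m≤m+n a c)) b∈S (+-closed S a∈S c∈S) (subst Ap (swap a b c) ap))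
    ((gen≢+ ga b>0 c>0 b∈S c∈S ∷ a≢b ∷ <⇒≢ (m<m+n a c>0) ∷ []) ∷
     (≢-sym (<⇒≢ (m<m+n b c>0)) ∷ (λ eq → a≢b (sym (+-cancelʳ-≡ c b a eq))) ∷ []) ∷
     (gen≢+ gb a>0 c>0 a∈S c∈S ∷ []) ∷ [] ∷ [])
    where
    a>0 = gen>0 ga
    b>0 = gen>0 gb
    c>0 = gen>0 gc
    a∈S = gen∈S ga
    b∈S = gen∈S gb
    c∈S = gen∈S gc
    swap : ∀ a b c → a + (b + c) ≡ b + (a + c)
    swap = solve-∀

  -- The property that `tower` iterates. It holds outright when a is the only factor available;
  -- otherwise a different factor of s yields the goal by `mixed`.
  Extends : ℕ → Set
  Extends a = ∀ {s} → In s → 0 < s → Ap (a + (a + s)) → Goal ⊎ (∃ λ t → In t × s ≡ a + t)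

  -- Copies of a move from s into the multiple until s is 0 or j of them have moved. The multiple
  -- starts with the two copies that `Extends` asks for.
  tower : ∀ {a} → In a → Extends a → ∀ j k {s} → In s → Ap (suc (suc k) * a + s) →
    Goal ⊎ ((∃ λ i → i < j × suc (suc k) * a + s ≡ (suc (suc k) + i) * a) ⊎ Ap ((suc (suc k) + j) * a))
  tower {a} a∈S extend zero k {s} s∈S ap = inj₂ (inj₂
    (subst (λ i → Ap (i * a)) (sym (+-identityʳ (suc (suc k)))) (ap-+ˡ _ s (multiple-in (suc (suc k)) a∈S) s∈S ap)))
  tower {a} a∈S extend (suc j) k {zero} s∈S ap = inj₂ (inj₁ (0 , z<s , swap k a))
    where
    swap : ∀ k a → suc (suc k) * a + 0 ≡ (suc (suc k) + 0) * a
    swap = solve-∀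
  tower {a} a∈S extend (suc j) k {s@(suc _)} s∈S ap
    with extend s∈S z<s (ap-+ˡ (a + (a + s)) (k * a) (+-closed S a∈S (+-closed S a∈S s∈S)) (multiple-in k a∈S) (subst Ap (swap k a s) ap))
    where
    swap : ∀ k a s → suc (suc k) * a + s ≡ a + (a + s) + k * a
    swap = solve-∀
  ... | inj₁ goal = inj₁ goal
  ... | inj₂ (t , t∈S , s≡a+t) with tower a∈S extend j (suc k) t∈S (subst Ap shift ap)
    where
    swap : ∀ k a t → suc (suc k) * a + (a + t) ≡ suc (suc (suc k)) * a + t
    swap = solve-∀
    shift : suc (suc k) * a + s ≡ suc (suc (suc k)) * a + t
    shift = trans (cong (suc (suc k) * a +_) s≡a+t) (swap k a t)
  ...   | inj₁ goal = inj₁ goal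
  ...   | inj₂ (inj₂ ap′) = inj₂ (inj₂ (subst (λ i → Ap (i * a)) (sym (+-suc (suc (suc k)) j)) ap′))
  ...   | inj₂ (inj₁ (i , i<j , eq)) = inj₂ (inj₁ (suc i , s≤s i<j ,
            trans (cong (suc (suc k) * a +_) s≡a+t) (trans (swap k a t) (trans eq (cong (_* a) (sym (+-suc (suc (suc k)) i)))))))
    where
    swap : ∀ k a t → suc (suc k) * a + (a + t) ≡ suc (suc (suc k)) * a + t
    swap = solve-∀

  -- The shape of the elements of `ds`

  module _ {xs : List ℕ} (gens : ∀ {a} → a ∈ xs → Gen a) (factor : Factors xs) where

    -- Once a generator is split off, the rest is nonzero because d is not a generator, so it has a
    -- factor too.
    two-factors : ∀ {d} → d ∈ ds → ∃ λ a → a ∈ xs × ∃ λ b → b ∈ xs × ∃ λ s → In s × d ≡ a + (b + s)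
    two-factors p with factor (proj₂ (ds-part p)) (proj₁ (ds-part p))
    ... | a , a∈ , zero , _ , refl = contradiction (subst Gen (sym (+-identityʳ a)) (gens a∈)) (ds-nongen p)
    ... | a , a∈ , s@(suc _) , s∈S , refl
      with factor (ap-+ʳ a s (gen∈S (gens a∈)) s∈S (proj₂ (ds-part p))) z<s
    ...   | b , b∈ , t , t∈S , eq = a , a∈ , b , b∈ , t , t∈S , cong (a +_) eq

    -- A factor b ≠ a of s puts b + (a + a) into `Ap`, and `mixed` applies.
    extends : 3 ≤ ν → ∀ {a} → a ∈ xs → Extends a
    extends 3≤ν {a} a∈ {s} s∈S s>0 ap
      with factor (ap-+ʳ a s a∈S s∈S (ap-+ʳ a (a + s) a∈S (+-closed S a∈S s∈S) ap)) s>0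
      where a∈S = gen∈S (gens a∈)
    ... | b , b∈ , t , t∈S , refl with b ≟ a
    ...   | yes refl = inj₂ (t , t∈S , refl)
    ...   | no b≢a = inj₁ (mixed 3≤ν (gens b∈) (gens a∈) (gens a∈) b≢a
              (ap-+ˡ (b + (a + a)) t (+-closed S b∈S (+-closed S a∈S a∈S)) t∈S (subst Ap (swap a b t) ap)))
      where
      a∈S = gen∈S (gens a∈)
      b∈S = gen∈S (gens b∈)
      swap : ∀ a b t → a + (a + (b + t)) ≡ b + (a + a) + t
      swap = solve-∀

    -- The bound j cuts off the list 3 a, 4 a, … of pure multiples: beyond it only (3 + j) a ∈ Ap is recorded.
    classify : 3 ≤ ν → ∀ j {d} → d ∈ ds → Goal ⊎
      ((∃ λ a → a ∈ xs × ∃ λ b → b ∈ xs × d ≡ a + b) ⊎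
       (∃ λ a → a ∈ xs × Ap (3 * a) × ((∃ λ i → i < j × d ≡ (3 + i) * a) ⊎ Ap ((3 + j) * a))))
    classify 3≤ν j {d} p with two-factors p
    ... | a , a∈ , b , b∈ , zero , _ , refl = inj₂ (inj₁ (a , a∈ , b , b∈ , cong (a +_) (+-identityʳ b)))
    ... | a , a∈ , b , b∈ , s@(suc _) , s∈S , refl
      with a ≟ b | factor (ap-+ʳ b s b∈S s∈S (ap-+ʳ a (b + s) a∈S (+-closed S b∈S s∈S) (proj₂ (ds-part p)))) z<s
      where
      a∈S = gen∈S (gens a∈)
      b∈S = gen∈S (gens b∈)
    ...   | no a≢b | c , c∈ , t , t∈S , eq = inj₁ (mixed 3≤ν (gens a∈) (gens b∈) (gens c∈) a≢b
              (ap-+ˡ (a + (b + c)) t (+-closed S (gen∈S (gens a∈)) (+-closed S (gen∈S (gens b∈)) (gen∈S (gens c∈)))) t∈S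
                (subst Ap (trans (cong (λ s → a + (b + s)) eq) (swap a b c t)) (proj₂ (ds-part p)))))
      where
      swap : ∀ a b c t → a + (b + (c + t)) ≡ a + (b + c) + t
      swap = solve-∀
    ...   | yes refl | _ with extends 3≤ν a∈ s∈S z<s (proj₂ (ds-part p))
    ...     | inj₁ goal = inj₁ goal
    -- The start `k = 1` records the three copies of a already split off.
    ...     | inj₂ (t , t∈S , eq) = conclude (tower a∈S (extends 3≤ν a∈) j 1 t∈S (subst Ap d≡ (proj₂ (ds-part p))))
      where
      a∈S = gen∈S (gens a∈)
      swap : ∀ a t → a + (a + (a + t)) ≡ 3 * a + t
      swap = solve-∀
      d≡ : a + (a + s) ≡ 3 * a + t
      d≡ = trans (cong (λ s → a + (a + s)) eq) (swap a t)
      3a : Ap (3 * a)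
      3a = ap-+ˡ (3 * a) t (multiple-in 3 a∈S) t∈S (subst Ap d≡ (proj₂ (ds-part p)))
      conclude : Goal ⊎ ((∃ λ i → i < j × 3 * a + t ≡ (3 + i) * a) ⊎ Ap ((3 + j) * a)) → _
      conclude (inj₁ goal) = inj₁ goal
      conclude (inj₂ (inj₁ (i , i<j , eq′))) = inj₂ (inj₂ (a , a∈ , 3a , inj₁ (i , i<j , trans d≡ eq′)))
      conclude (inj₂ (inj₂ ap)) = inj₂ (inj₂ (a , a∈ , 3a , inj₂ ap))

  -- One, two or three generators other than m

  one-generator : ∀ x → 2 ≤ ν → Gen x → Factors (x ∷ []) → Goal
  one-generator x 2≤ν gx factor with either-all {R = Goal ⊎ Ap (6 * x)} ds short
    where
    gens : ∀ {a} → a ∈ x ∷ [] → Gen a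
    gens (here refl) = gx
    extend : Extends x
    extend {s} s∈S s>0 ap with factor (ap-+ʳ x s (gen∈S gx) s∈S (ap-+ʳ x (x + s) (gen∈S gx) (+-closed S (gen∈S gx) s∈S) ap)) s>0
    ... | _ , here refl , t , t∈S , eq = inj₂ (t , t∈S , eq)
    swap : ∀ x s → x + (x + s) ≡ 2 * x + s
    swap = solve-∀
    -- The values 2 x, ..., 5 x are too few for `ds`, and the bound 4 in `tower` makes 6 x the next
    -- multiple.
    short : ∀ {d} → d ∈ ds → (Goal ⊎ Ap (6 * x)) ⊎ d ∈ applyUpTo (λ i → (2 + i) * x) 4
    short p with two-factors gens factor p
    ... | _ , here refl , _ , here refl , s , s∈S , refl
      with tower (gen∈S gx) extend 4 0 s∈S (subst Ap (swap x s) (proj₂ (ds-part p)))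
    ...   | inj₁ goal = inj₁ (inj₁ goal)
    ...   | inj₂ (inj₂ ap) = inj₁ (inj₂ ap)
    ...   | inj₂ (inj₁ (i , i<4 , eq)) = inj₂ (subst (_∈ applyUpTo (λ i → (2 + i) * x) 4) (sym (trans (swap x s) eq))
              (∈-applyUpTo⁺ (λ i → (2 + i) * x) i<4))
  ... | inj₁ (inj₁ goal) = goal
  ... | inj₂ inside = crowded _ ≤-refl (λ p → inj₂ (inside p))
  -- 6 x = x + 5 x = 2 x + 4 x = 3 x + 3 x covers x, ..., 5 x once each.
  ... | inj₁ (inj₂ 6x) = two-edges-loop 2≤ν
    (multiple-edge 0 4 gx 6x) (multiple-edge 1 3 gx 6x) (multiple-edge 2 2 gx 6x)
    ((multiple≢ 1 5 gx (λ ()) ∷ multiple≢ 1 2 gx (λ ()) ∷ multiple≢ 1 4 gx (λ ()) ∷ multiple≢ 1 3 gx (λ ()) ∷ []) ∷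
     (multiple≢ 5 2 gx (λ ()) ∷ multiple≢ 5 4 gx (λ ()) ∷ multiple≢ 5 3 gx (λ ()) ∷ []) ∷
     (multiple≢ 2 4 gx (λ ()) ∷ multiple≢ 2 3 gx (λ ()) ∷ []) ∷
     (multiple≢ 4 3 gx (λ ()) ∷ []) ∷ [] ∷ [])

  -- A value outside `ds` would, together with `ds`, give six distinct entries in a list of at most
  -- five.
  full : ∀ ys → length ys ≤ 5 → (∀ {d} → d ∈ ds → d ∈ ys) → ∀ {y} → y ∈ ys → y ∈ ds
  full ys small-ys ds⊆ {y} y∈ys with y ∈? ds
  ... | yes y∈ds = y∈ds
  ... | no  y∉ds = contradiction
    (≤-trans (s≤s 5≤length-ds) (≤-trans (⊆⇒length≤ (∉⇒All≢ y∉ds ∷ ds-unique) (λ { (here refl) → y∈ys ; (there p) → ds⊆ p })) small-ys))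
    (<⇒≱ ≤-refl)

  two-generators : ∀ x y → 3 ≤ ν → x ≢ y → Gen x → Gen y → Factors (x ∷ y ∷ []) → Goal
  two-generators x y 3≤ν x≢y gx gy factor = combine (triple-in-Ap x y x≢y gx gy (λ { (here p) → inj₁ p ; (there (here p)) → inj₂ p }))
                                                  (triple-in-Ap y x (≢-sym x≢y) gy gx (λ { (here p) → inj₂ p ; (there (here p)) → inj₁ p }))
    where
    gens : ∀ {a} → a ∈ x ∷ y ∷ [] → Gen a
    gens (here refl) = gx
    gens (there (here refl)) = gy

    5a : ∀ {a} → Gen a → Ap (5 * a) → Goal
    5a ga ap = two-edges 3≤ν (multiple-edge 0 3 ga ap) (multiple-edge 1 2 ga ap)
      ((multiple≢ 1 4 ga (λ ()) ∷ multiple≢ 1 2 ga (λ ()) ∷ multiple≢ 1 3 ga (λ ()) ∷ []) ∷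
       (multiple≢ 4 2 ga (λ ()) ∷ multiple≢ 4 3 ga (λ ()) ∷ []) ∷ (multiple≢ 2 3 ga (λ ()) ∷ []) ∷ [] ∷ [])

    double : ∀ a → a + a ≡ 2 * a
    double = solve-∀

    -- Unless 3 a occurs or 5 b finishes, only the five sums in `ys` remain, and by `full` all
    -- occur. Then 4 b gives the edge {b, 3 b} and the loop at 2 b, and 2 a the loop at a.
    triple-in-Ap : ∀ a b → a ≢ b → Gen a → Gen b → (∀ {c} → c ∈ x ∷ y ∷ [] → c ≡ a ⊎ c ≡ b) → Goal ⊎ Ap (3 * a)
    triple-in-Ap a b a≢b ga gb a-or-b
      with either-all {R = Goal ⊎ Ap (3 * a)} {P = _∈ ys} ds inside
      where
      ys = a + b ∷ 2 * a ∷ 2 * b ∷ 3 * b ∷ 4 * b ∷ []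
      inside : ∀ {d} → d ∈ ds → (Goal ⊎ Ap (3 * a)) ⊎ d ∈ ys
      inside p with classify gens factor 3≤ν 2 p
      ... | inj₁ goal = inj₁ (inj₁ goal)
      ... | inj₂ (inj₁ (u , u∈ , v , v∈ , refl)) with a-or-b u∈ | a-or-b v∈
      ...   | inj₁ refl | inj₁ refl = inj₂ (there (here (double u)))
      ...   | inj₁ refl | inj₂ refl = inj₂ (here refl)
      ...   | inj₂ refl | inj₁ refl = inj₂ (here (+-comm u v))
      ...   | inj₂ refl | inj₂ refl = inj₂ (there (there (here (double u))))
      inside p | inj₂ (inj₂ (u , u∈ , 3u , rest)) with a-or-b u∈ | rest
      ...   | inj₁ refl | _ = inj₁ (inj₂ 3u)
      ...   | inj₂ refl | inj₂ 5u = inj₁ (inj₁ (5a gb 5u))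
      ...   | inj₂ refl | inj₁ (0 , _ , eq) = inj₂ (there (there (there (here eq))))
      ...   | inj₂ refl | inj₁ (1 , _ , eq) = inj₂ (there (there (there (there (here eq)))))
      ...   | inj₂ refl | inj₁ (suc (suc _) , s≤s (s≤s ()) , _)
    ... | inj₁ r = r
    ... | inj₂ ds⊆ = inj₁ (edge-two-loops 3≤ν (multiple-edge 0 2 gb 4b) (multiple-edge 1 1 gb 4b)
                       (edge (gen>0 ga) (gen>0 ga) (gen∈S ga) (gen∈S ga) (subst Ap (sym (double a)) 2a))
                       ((multiple≢ 1 3 gb (λ ()) ∷ multiple≢ 1 2 gb (λ ()) ∷ ≢-sym (gen≢multiple gb ga a≢b 0) ∷ []) ∷
                        (multiple≢ 3 2 gb (λ ()) ∷ ≢-sym (gen≢multiple gb ga a≢b 2) ∷ []) ∷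
                        (≢-sym (gen≢multiple gb ga a≢b 1) ∷ []) ∷ [] ∷ []))
      where
      4b : Ap (4 * b)
      4b = proj₂ (ds-part (full _ ≤-refl ds⊆ (there (there (there (there (here refl)))))))
      2a : Ap (2 * a)
      2a = proj₂ (ds-part (full _ ≤-refl ds⊆ (there (here refl))))

    combine : Goal ⊎ Ap (3 * x) → Goal ⊎ Ap (3 * y) → Goal
    combine (inj₁ goal) _           = goal
    combine (inj₂ _)    (inj₁ goal) = goal
    -- The edges are {x, 2 x} and {y, 2 y}.
    combine (inj₂ 3x)   (inj₂ 3y)   = two-edges 3≤ν (edge (gen>0 gx) (≤-trans (gen>0 gx) (m≤m+n x _)) (gen∈S gx) (multiple-in 2 (gen∈S gx)) 3x)
      (edge (gen>0 gy) (≤-trans (gen>0 gy) (m≤m+n y _)) (gen∈S gy) (multiple-in 2 (gen∈S gy)) 3y)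
      ((<⇒≢ (m<m+n x (≤-trans (gen>0 gx) (m≤m+n x 0))) ∷ x≢y ∷ gen≢multiple gy gx x≢y 1 ∷ []) ∷
       (≢-sym (gen≢multiple gx gy (≢-sym x≢y) 1) ∷ (λ eq → x≢y (*-cancelˡ-≡ x y 2 eq)) ∷ []) ∷
       (<⇒≢ (m<m+n y (≤-trans (gen>0 gy) (m≤m+n y 0))) ∷ []) ∷ [] ∷ [])

  three-generators : ∀ x y z → 4 ≤ ν → Unique (x ∷ y ∷ z ∷ []) → (∀ {a} → a ∈ x ∷ y ∷ z ∷ [] → Gen a) →
    Factors (x ∷ y ∷ z ∷ []) → Goal
  three-generators x y z 4≤ν ((x≢y ∷ x≢z ∷ []) ∷ (y≢z ∷ []) ∷ [] ∷ []) gens factor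
    with either-all {R = Goal ⊎ (∃ λ a → a ∈ xs × Ap (3 * a))} {P = λ d → ∃ λ a → a ∈ xs × ∃ λ b → b ∈ xs × d ≡ a + b} ds split
    where
    xs = x ∷ y ∷ z ∷ []
    split : ∀ {d} → d ∈ ds → (Goal ⊎ (∃ λ a → a ∈ xs × Ap (3 * a))) ⊎ (∃ λ a → a ∈ xs × ∃ λ b → b ∈ xs × d ≡ a + b)
    split p with classify gens factor (<⇒≤ 4≤ν) 0 p
    ... | inj₁ goal = inj₁ (inj₁ goal)
    ... | inj₂ (inj₁ quad) = inj₂ quad
    ... | inj₂ (inj₂ (a , a∈ , 3a , _)) = inj₁ (inj₂ (a , a∈ , 3a))
  ... | inj₁ (inj₁ goal) = goal
  -- Beside the edge {a, 2 a}, a loop at another generator or an edge between two others finishes,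
  -- and so does 4 a in `Ap`. Four values are left.
  ... | inj₁ (inj₂ (a , a∈ , 3a)) = crowded (3 * a ∷ map (a +_) xs) ≤-refl inside
    where
    xs = x ∷ y ∷ z ∷ []
    ga = gens a∈
    other-loop : ∀ {b} → Gen b → b ≢ a → Ap (b + b) → Goal
    other-loop gb b≢a ap = edge-loop 4≤ν (multiple-edge 0 1 ga 3a) (edge (gen>0 gb) (gen>0 gb) (gen∈S gb) (gen∈S gb) ap)
      ((multiple≢ 1 2 ga (λ ()) ∷ ≢-sym (gen≢multiple ga gb b≢a 0) ∷ []) ∷ (≢-sym (gen≢multiple ga gb b≢a 1) ∷ []) ∷ [] ∷ [])
    4a : ∀ {b} → Gen b → Ap (4 * b) → Goal
    4a gb ap = edge-loop 4≤ν (multiple-edge 0 2 gb ap) (multiple-edge 1 1 gb ap)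
      ((multiple≢ 1 3 gb (λ ()) ∷ multiple≢ 1 2 gb (λ ()) ∷ []) ∷ (multiple≢ 3 2 gb (λ ()) ∷ []) ∷ [] ∷ [])
    double : ∀ a → a + a ≡ 2 * a
    double = solve-∀
    inside : ∀ {d} → d ∈ ds → Goal ⊎ d ∈ 3 * a ∷ map (a +_) xs
    inside p with classify gens factor (<⇒≤ 4≤ν) 1 p
    ... | inj₁ goal = inj₁ goal
    ... | inj₂ (inj₂ (b , b∈ , 3b , rest)) with b ≟ a | rest
    ...   | no b≢a   | _ = inj₁ (other-loop (gens b∈) b≢a (subst Ap (sym (double b)) (ap-multiple 2 1 (gen∈S (gens b∈)) 3b)))
    ...   | yes refl | inj₁ (0 , _ , eq) = inj₂ (here eq)
    ...   | yes refl | inj₁ (suc _ , s≤s () , _)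
    ...   | yes refl | inj₂ ap = inj₁ (4a ga ap)
    inside p | inj₂ (inj₁ (b , b∈ , c , c∈ , refl)) with b ≟ a | c ≟ a | b ≟ c
    ...   | yes refl | _        | _        = inj₂ (there (∈-map⁺ (a +_) c∈))
    ...   | no _     | yes refl | _        = inj₂ (there (subst (_∈ map (a +_) xs) (+-comm a b) (∈-map⁺ (a +_) b∈)))
    ...   | no b≢a   | no _     | yes refl = inj₁ (other-loop (gens b∈) b≢a (proj₂ (ds-part p)))
    ...   | no b≢a   | no c≢a   | no b≢c   = inj₁ (two-edges (<⇒≤ 4≤ν) (multiple-edge 0 1 ga 3a)
              (edge (gen>0 (gens b∈)) (gen>0 (gens c∈)) (gen∈S (gens b∈)) (gen∈S (gens c∈)) (proj₂ (ds-part p)))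
              ((multiple≢ 1 2 ga (λ ()) ∷ ≢-sym (gen≢multiple ga (gens b∈) b≢a 0) ∷ ≢-sym (gen≢multiple ga (gens c∈) c≢a 0) ∷ []) ∷
               (≢-sym (gen≢multiple ga (gens b∈) b≢a 1) ∷ ≢-sym (gen≢multiple ga (gens c∈) c≢a 1) ∷ []) ∷ (b≢c ∷ []) ∷ [] ∷ []))
  ... | inj₂ quads = finish (pair-or-missing x y z x∈ y∈ z∈ x≢y x≢z y≢z) (pair-or-missing x z y x∈ z∈ y∈ x≢z x≢y (≢-sym y≢z))
    where
    xs = x ∷ y ∷ z ∷ []
    x∈ : x ∈ xs
    x∈ = here refl
    y∈ : y ∈ xs
    y∈ = there (here refl)
    z∈ : z ∈ xs
    z∈ = there (there (here refl))
    -- If both sums occur, the edge {a, b} and the loop at c are disjoint.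
    pair-or-missing : ∀ a b c → a ∈ xs → b ∈ xs → c ∈ xs → a ≢ b → a ≢ c → b ≢ c →
      Goal ⊎ (∃ λ p → p ∉ ds × (p ≡ a + b ⊎ p ≡ c + c))
    pair-or-missing a b c a∈ b∈ c∈ a≢b a≢c b≢c with (a + b) ∈? ds | (c + c) ∈? ds
    ... | no ab∉ | _      = inj₂ (a + b , ab∉ , inj₁ refl)
    ... | yes _  | no cc∉ = inj₂ (c + c , cc∉ , inj₂ refl)
    ... | yes ab | yes cc = inj₁ (edge-loop 4≤ν
      (edge (gen>0 (gens a∈)) (gen>0 (gens b∈)) (gen∈S (gens a∈)) (gen∈S (gens b∈)) (proj₂ (ds-part ab)))
      (edge (gen>0 (gens c∈)) (gen>0 (gens c∈)) (gen∈S (gens c∈)) (gen∈S (gens c∈)) (proj₂ (ds-part cc)))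
      ((a≢b ∷ a≢c ∷ []) ∷ (b≢c ∷ []) ∷ [] ∷ []))
    -- Each edge is listed with the loop at the third generator.
    six = x + y ∷ z + z ∷ x + z ∷ y + y ∷ y + z ∷ x + x ∷ []
    ds⊆six : ∀ {d} → d ∈ ds → d ∈ six
    ds⊆six p with quads p
    ... | _ , here refl                 , _ , here refl                 , refl = there (there (there (there (there (here refl)))))
    ... | _ , here refl                 , _ , there (here refl)         , refl = here refl
    ... | _ , here refl                 , _ , there (there (here refl)) , refl = there (there (here refl))
    ... | _ , there (here refl)         , _ , here refl                 , refl = here (+-comm y x)
    ... | _ , there (here refl)         , _ , there (here refl)         , refl = there (there (there (here refl)))
    ... | _ , there (here refl)         , _ , there (there (here refl)) , refl = there (there (there (there (here refl))))
    ... | _ , there (there (here refl)) , _ , here refl                 , refl = there (there (here (+-comm z x)))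
    ... | _ , there (there (here refl)) , _ , there (here refl)         , refl = there (there (there (there (here (+-comm z y)))))
    ... | _ , there (there (here refl)) , _ , there (there (here refl)) , refl = there (here refl)
    distinct : ∀ {p p′} → (p ≡ x + y ⊎ p ≡ z + z) → (p′ ≡ x + z ⊎ p′ ≡ y + y) → p ≢ p′
    distinct (inj₁ refl) (inj₁ refl) eq = y≢z (+-cancelˡ-≡ x y z eq)
    distinct (inj₁ refl) (inj₂ refl) eq = x≢y (+-cancelʳ-≡ y x y eq)
    distinct (inj₂ refl) (inj₁ refl) eq = x≢z (sym (+-cancelʳ-≡ z z x eq))
    distinct (inj₂ refl) (inj₂ refl) eq = y≢z (sym (*-cancelˡ-≡ z y 2 (trans (2* z) (trans eq (sym (2* y))))))
      where
      2* : ∀ a → 2 * a ≡ a + a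
      2* = solve-∀
    finish : Goal ⊎ (∃ λ p → p ∉ ds × (p ≡ x + y ⊎ p ≡ z + z)) → Goal ⊎ (∃ λ p → p ∉ ds × (p ≡ x + z ⊎ p ≡ y + y)) → Goal
    finish (inj₁ goal) _ = goal
    finish (inj₂ _) (inj₁ goal) = goal
    -- Two of the six sums are missing, yet `ds` needs five.
    finish (inj₂ (p , p∉ , eq)) (inj₂ (p′ , p′∉ , eq′)) = contradiction
      (≤-trans (s≤s (s≤s 5≤length-ds)) (⊆⇒length≤ {ys = six}
        ((distinct eq eq′ ∷ ∉⇒All≢ p∉) ∷ ∉⇒All≢ p′∉ ∷ ds-unique)
        (λ { (here refl) → first eq ; (there (here refl)) → second eq′ ; (there (there d∈)) → ds⊆six d∈ })))
      (<⇒≱ ≤-refl)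
      where
      first : (p ≡ x + y ⊎ p ≡ z + z) → p ∈ six
      first (inj₁ eq) = here eq
      first (inj₂ eq) = there (here eq)
      second : (p′ ≡ x + z ⊎ p′ ≡ y + y) → p′ ∈ six
      second (inj₁ eq) = there (there (here eq))
      second (inj₂ eq) = there (there (there (here eq)))

  wilf : Goal
  wilf = by-generators as as-unique length-as<ν as-gen factors
    where
    by-generators : ∀ xs → Unique xs → length xs < ν → (∀ {a} → a ∈ xs → Gen a) → Factors xs → Goal
    -- With no generator besides m, `ds` would be empty.
    by-generators [] _ _ gens factor = crowded [] z≤n λ p →
      contradiction (proj₁ (proj₂ (factor (proj₂ (ds-part p)) (proj₁ (ds-part p))))) λ ()
    by-generators (x ∷ []) _ 2≤ν gens factor = one-generator x 2≤ν (gens (here refl)) factor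
    by-generators (x ∷ y ∷ []) ((x≢y ∷ []) ∷ _) 3≤ν gens factor =
      two-generators x y 3≤ν x≢y (gens (here refl)) (gens (there (here refl))) factor
    by-generators (x ∷ y ∷ z ∷ []) xs! 4≤ν gens factor = three-generators x y z 4≤ν xs! gens factor
    by-generators (_ ∷ _ ∷ _ ∷ _ ∷ xs) _ len _ _ = many-generators (≤-trans (s≤s (s≤s (s≤s (s≤s (s≤s z≤n))))) len)

theorem2 : (S : NumericalSemigroup) (f m ν n : ℕ) →
    IsFrobenius S f → IsMultiplicity S m → IsEmbeddingDimension S ν →
    IsSmallElementsCount S f n → m ≡ ν + 5 →
    f + 1 ≤ ν * n
theorem2 S f m ν n frobenius multiplicity embedding small m≡ν+5 =
  Wilf.wilf S f m ν n frobenius multiplicity embedding small m≡ν+5
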